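{- Consider the 2-person non-initialized game $(\mathcal{G}_2,u)$ under the Markov realization. If the payoff $u$ satisfies $$u_1(c)>u_1(a_1)>u_1(a_2),\qquad u_2(a_1)>u_2(a_2)>u_2(c),$$ then $(\mathcal{G}_2,u)$ has no uniform Nash equilibrium in mixed strategies.
   Context: Game structure $\mathcal{G}_2$: the directed graph has non-terminal positions $v_1,v_2$, terminal positions $a_1,a_2$, and arcs $(v_1,v_2),(v_2,v_1),(v_1,a_1),(v_2,a_2)$. Player $i\in\{1,2\}$ controls $v_i$. The outcomes are $a_1,a_2$ (termination there) and $c$ (infinite play). A payoff is $u:\{1,2\}\times\{a_1,a_2,c\}\to\mathbb{R}$, written $u_i(a)$. A mixed strategy of player $i$ is a number $p_i\in[0,1]$: the probability of following the cycle (moving to the other non-terminal position); with probability $1-p_i$ the player moves to $a_i$. Under the Markov realization the move is drawn afresh and independently each time a position is visited. Thus if $p_1=p_2=1$ the outcome is $c$ with probability 1 from either initial position; otherwise the distribution on $(a_1,a_2,c)$ is $\left(\frac{1-p_1}{1-p_1p_2},\frac{p_1(1-p_2)}{1-p_1p_2},0\right)$ for initial position $v_1$ and $\left(\frac{p_2(1-p_1)}{1-p_1p_2},\frac{1-p_2}{1-p_1p_2},0\right)$ for initial position $v_2$. Player $i$'s expected payoff is the corresponding expectation of $u_i$. A pair $(p_1,p_2)\in[0,1]^2$ is a uniform Nash equilibrium (UNE) if for each initial position $v_j$, $j=1,2$, no player can strictly increase his expected payoff by changing only his own $p_i\in[0,1]$. -}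

module Defs where

open import Data.Nat.Base as ℕ using (ℕ)
import Data.Nat.Properties as ℕ
open import Data.Product using (∃; _×_; _,_)
open import Data.Rational.Base as ℚ using (ℚ; 0ℚ; 1ℚ; ½; ∣_∣)
import Data.Rational.Properties as ℚ
open import Data.Rational.Solver using (module +-*-Solver)
open import Data.Sum using (_⊎_; inj₁; inj₂)
open import Relation.Binary.PropositionalEquality
  using (_≡_; refl; sym; trans; cong; cong₂; subst; subst₂)
open import Relation.Nullary using (¬_; yes; no; contradiction)

------------------------------------------------------------------------
-- Real numbers: rational Cauchy sequences up to _≈_

IsCauchy : (ℕ → ℚ) → Set
IsCauchy x = ∀ ε → 0ℚ ℚ.< ε →
  ∃ λ N → ∀ m n → N ℕ.≤ m → N ℕ.≤ n → ∣ x m ℚ.- x n ∣ ℚ.< ε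

record ℝ : Set where
  constructor mkℝ
  field
    seq    : ℕ → ℚ
    cauchy : IsCauchy seq

open ℝ public

infix 4 _≈_ _<_ _>_ _≤_ _#_

_≈_ : ℝ → ℝ → Set
x ≈ y = ∀ ε → 0ℚ ℚ.< ε →
  ∃ λ N → ∀ n → N ℕ.≤ n → ∣ seq x n ℚ.- seq y n ∣ ℚ.< ε

-- The gap ε has to be uniform: termwise strict inequality does not survive
-- passing to the limit.
_<_ : ℝ → ℝ → Set
x < y = ∃ λ ε → 0ℚ ℚ.< ε ×
  ∃ λ N → ∀ n → N ℕ.≤ n → seq x n ℚ.+ ε ℚ.< seq y n

_>_ : ℝ → ℝ → Set
x > y = y < x

_≤_ : ℝ → ℝ → Set
x ≤ y = ¬ (y < x)

-- Apartness, the positive form of x ≉ y; classically the two agree.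
_#_ : ℝ → ℝ → Set
x # y = x < y ⊎ y < x

abstract

  split-+ : ∀ a b c d → (a ℚ.+ b) ℚ.- (c ℚ.+ d) ≡ (a ℚ.- c) ℚ.+ (b ℚ.- d)
  split-+ = solve 4 (λ a b c d →
    (a :+ b) :- (c :+ d) := (a :- c) :+ (b :- d)) refl
    where open +-*-Solver

  split-neg : ∀ a b → (ℚ.- a) ℚ.- (ℚ.- b) ≡ ℚ.- (a ℚ.- b)
  split-neg = solve 2 (λ a b → (:- a) :- (:- b) := :- (a :- b)) refl
    where open +-*-Solver

  split-* : ∀ a b c d →
    (a ℚ.* b) ℚ.- (c ℚ.* d) ≡ a ℚ.* (b ℚ.- d) ℚ.+ d ℚ.* (a ℚ.- c)
  split-* = solve 4 (λ a b c d →
    (a :* b) :- (c :* d) := a :* (b :- d) :+ d :* (a :- c)) refl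
    where open +-*-Solver

  split-inv : ∀ r s a b →
    (r ℚ.- s) ℚ.* (a ℚ.* b) ≡ (r ℚ.* a) ℚ.* b ℚ.- (s ℚ.* b) ℚ.* a
  split-inv = solve 4 (λ r s a b →
    (r :- s) :* (a :* b) := (r :* a) :* b :- (s :* b) :* a) refl
    where open +-*-Solver

  a≡b+[a-b] : ∀ a b → a ≡ b ℚ.+ (a ℚ.- b)
  a≡b+[a-b] = solve 2 (λ a b → a := b :+ (a :- b)) refl
    where open +-*-Solver

  -[a-b]≡b-a : ∀ a b → ℚ.- (a ℚ.- b) ≡ b ℚ.- a
  -[a-b]≡b-a = solve 2 (λ a b → :- (a :- b) := b :- a) refl
    where open +-*-Solver

  half+half : ∀ a → a ℚ.* ½ ℚ.+ a ℚ.* ½ ≡ a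
  half+half a =
    trans (sym (ℚ.*-distribˡ-+ a ½ ½)) (ℚ.*-identityʳ a)

  0<* : ∀ {a b} → 0ℚ ℚ.< a → 0ℚ ℚ.< b → 0ℚ ℚ.< a ℚ.* b
  0<* {a} {b} 0<a 0<b =
    ℚ.positive⁻¹ (a ℚ.* b)
      {{ℚ.pos*pos⇒pos a {{ℚ.positive 0<a}} b {{ℚ.positive 0<b}}}}

  quotient : ∀ B → 0ℚ ℚ.< B → ∀ ε → 0ℚ ℚ.< ε →
    ∃ λ η → 0ℚ ℚ.< η × B ℚ.* η ≡ ε
  quotient B 0<B ε 0<ε = 1/B ℚ.* ε , 0<* (ℚ.positive⁻¹ 1/B {{1/B>0}}) 0<ε ,
    trans (sym (ℚ.*-assoc B 1/B ε))
      (trans (cong (ℚ._* ε) (ℚ.*-inverseʳ B {{B≢0}})) (ℚ.*-identityˡ ε))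
    where
    B≢0 : ℚ.NonZero B
    B≢0 = ℚ.pos⇒nonZero B {{ℚ.positive 0<B}}
    1/B : ℚ
    1/B = ℚ.1/_ B {{B≢0}}
    1/B>0 : ℚ.Positive 1/B
    1/B>0 = ℚ.1/pos⇒pos B {{ℚ.positive 0<B}}

  *-mono-<′ : ∀ {a b c d} → 0ℚ ℚ.≤ a → a ℚ.< b → 0ℚ ℚ.≤ c → c ℚ.< d →
    a ℚ.* c ℚ.< b ℚ.* d
  *-mono-<′ {a} {b} {c} {d} 0≤a a<b 0≤c c<d = ℚ.≤-<-trans
    (ℚ.*-monoʳ-≤-nonNeg c {{ℚ.nonNegative 0≤c}} (ℚ.<⇒≤ a<b))
    (ℚ.*-monoʳ-<-pos b {{ℚ.positive (ℚ.≤-<-trans 0≤a a<b)}} c<d)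

  p≤∣p∣ : ∀ p → p ℚ.≤ ∣ p ∣
  p≤∣p∣ p with ℚ.≤-total 0ℚ p
  ... | inj₁ 0≤p = ℚ.≤-reflexive (sym (ℚ.0≤p⇒∣p∣≡p 0≤p))
  ... | inj₂ p≤0 = ℚ.≤-trans p≤0 (ℚ.0≤∣p∣ p)

  bounded : ∀ x → IsCauchy x → ∃ λ B → 0ℚ ℚ.< B ×
    ∃ λ N → ∀ n → N ℕ.≤ n → ∣ x n ∣ ℚ.< B
  bounded x cx with cx 1ℚ (ℚ.positive⁻¹ 1ℚ)
  ... | N , close = ∣ x N ∣ ℚ.+ 1ℚ , 0<B , N , bound
    where
    0<B : 0ℚ ℚ.< ∣ x N ∣ ℚ.+ 1ℚ
    0<B = ℚ.+-mono-≤-< (ℚ.0≤∣p∣ (x N)) (ℚ.positive⁻¹ 1ℚ)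
    bound : ∀ n → N ℕ.≤ n → ∣ x n ∣ ℚ.< ∣ x N ∣ ℚ.+ 1ℚ
    bound n N≤n = subst (λ z → ∣ z ∣ ℚ.< ∣ x N ∣ ℚ.+ 1ℚ)
      (sym (a≡b+[a-b] (x n) (x N)))
      (ℚ.≤-<-trans (ℚ.∣p+q∣≤∣p∣+∣q∣ (x N) (x n ℚ.- x N))
        (ℚ.+-monoʳ-< ∣ x N ∣ (close n N N≤n ℕ.≤-refl)))

  +-cauchy : ∀ x y → IsCauchy x → IsCauchy y → IsCauchy (λ n → x n ℚ.+ y n)
  +-cauchy x y cx cy ε 0<ε
    with cx (ε ℚ.* ½) (0<* 0<ε (ℚ.positive⁻¹ ½))
       | cy (ε ℚ.* ½) (0<* 0<ε (ℚ.positive⁻¹ ½))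
  ... | M , closeˣ | N , closeʸ = M ℕ.⊔ N , λ m n hm hn →
    subst₂ (λ z e → ∣ z ∣ ℚ.< e)
      (sym (split-+ (x m) (y m) (x n) (y n))) (half+half ε)
      (ℚ.≤-<-trans (ℚ.∣p+q∣≤∣p∣+∣q∣ (x m ℚ.- x n) (y m ℚ.- y n))
        (ℚ.+-mono-<
          (closeˣ m n (ℕ.m⊔n≤o⇒m≤o M N hm) (ℕ.m⊔n≤o⇒m≤o M N hn))
          (closeʸ m n (ℕ.m⊔n≤o⇒n≤o M N hm) (ℕ.m⊔n≤o⇒n≤o M N hn))))

  neg-cauchy : ∀ x → IsCauchy x → IsCauchy (λ n → ℚ.- x n)
  neg-cauchy x cx ε 0<ε with cx ε 0<ε
  ... | N , close = N , λ m n hm hn →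
    subst (ℚ._< ε)
      (sym (trans (cong ∣_∣ (split-neg (x m) (x n)))
                  (ℚ.∣-p∣≡∣p∣ (x m ℚ.- x n))))
      (close m n hm hn)

  *-close : ∀ {A B η} a b c d →
    ∣ a ∣ ℚ.< A → ∣ d ∣ ℚ.< B → ∣ b ℚ.- d ∣ ℚ.< η → ∣ a ℚ.- c ∣ ℚ.< η →
    ∣ a ℚ.* b ℚ.- c ℚ.* d ∣ ℚ.< (A ℚ.+ B) ℚ.* η
  *-close {A} {B} {η} a b c d a<A d<B b-d<η a-c<η = begin-strict
    ∣ a ℚ.* b ℚ.- c ℚ.* d ∣
      ≡⟨ cong ∣_∣ (split-* a b c d) ⟩
    ∣ a ℚ.* (b ℚ.- d) ℚ.+ d ℚ.* (a ℚ.- c) ∣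
      ≤⟨ ℚ.∣p+q∣≤∣p∣+∣q∣ (a ℚ.* (b ℚ.- d)) (d ℚ.* (a ℚ.- c)) ⟩
    ∣ a ℚ.* (b ℚ.- d) ∣ ℚ.+ ∣ d ℚ.* (a ℚ.- c) ∣
      ≡⟨ cong₂ ℚ._+_ (ℚ.∣p*q∣≡∣p∣*∣q∣ a (b ℚ.- d))
                     (ℚ.∣p*q∣≡∣p∣*∣q∣ d (a ℚ.- c)) ⟩
    ∣ a ∣ ℚ.* ∣ b ℚ.- d ∣ ℚ.+ ∣ d ∣ ℚ.* ∣ a ℚ.- c ∣
      <⟨ ℚ.+-mono-<
           (*-mono-<′ (ℚ.0≤∣p∣ a) a<A (ℚ.0≤∣p∣ (b ℚ.- d)) b-d<η)
           (*-mono-<′ (ℚ.0≤∣p∣ d) d<B (ℚ.0≤∣p∣ (a ℚ.- c)) a-c<η) ⟩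
    A ℚ.* η ℚ.+ B ℚ.* η
      ≡⟨ ℚ.*-distribʳ-+ η A B ⟨
    (A ℚ.+ B) ℚ.* η ∎
    where open ℚ.≤-Reasoning

  *-cauchy : ∀ x y → IsCauchy x → IsCauchy y → IsCauchy (λ n → x n ℚ.* y n)
  *-cauchy x y cx cy ε 0<ε =
    let A , 0<A , K , ∣x∣<A = bounded x cx
        B , 0<B , L , ∣y∣<B = bounded y cy
        η , 0<η , [A+B]η≡ε  = quotient (A ℚ.+ B) (ℚ.+-mono-< 0<A 0<B) ε 0<ε
        M , closeˣ          = cx η 0<η
        N , closeʸ          = cy η 0<η
    in (K ℕ.⊔ L) ℕ.⊔ (M ℕ.⊔ N) , λ m n hm hn →
    let KL≤m = ℕ.m⊔n≤o⇒m≤o (K ℕ.⊔ L) (M ℕ.⊔ N) hm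
        KL≤n = ℕ.m⊔n≤o⇒m≤o (K ℕ.⊔ L) (M ℕ.⊔ N) hn
        MN≤m = ℕ.m⊔n≤o⇒n≤o (K ℕ.⊔ L) (M ℕ.⊔ N) hm
        MN≤n = ℕ.m⊔n≤o⇒n≤o (K ℕ.⊔ L) (M ℕ.⊔ N) hn
    in ℚ.<-≤-trans
      (*-close {A} {B} {η} (x m) (y m) (x n) (y n)
        (∣x∣<A m (ℕ.m⊔n≤o⇒m≤o K L KL≤m))
        (∣y∣<B n (ℕ.m⊔n≤o⇒n≤o K L KL≤n))
        (closeʸ m n (ℕ.m⊔n≤o⇒n≤o M N MN≤m) (ℕ.m⊔n≤o⇒n≤o M N MN≤n))
        (closeˣ m n (ℕ.m⊔n≤o⇒m≤o M N MN≤m) (ℕ.m⊔n≤o⇒m≤o M N MN≤n)))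
      (ℚ.≤-reflexive [A+B]η≡ε)

infixl 6 _+_ _-_
infixl 7 _*_ _÷_⟨_⟩
infix  8 -_

fromℚ : ℚ → ℝ
fromℚ q = mkℝ (λ _ → q) λ ε 0<ε → 0 , λ _ _ _ _ →
  subst (λ z → ∣ z ∣ ℚ.< ε) (sym (ℚ.+-inverseʳ q)) 0<ε

0ℝ 1ℝ : ℝ
0ℝ = fromℚ 0ℚ
1ℝ = fromℚ 1ℚ

_+_ : ℝ → ℝ → ℝ
x + y = mkℝ (λ n → seq x n ℚ.+ seq y n)
            (+-cauchy (seq x) (seq y) (cauchy x) (cauchy y))

-_ : ℝ → ℝ
- x = mkℝ (λ n → ℚ.- seq x n) (neg-cauchy (seq x) (cauchy x))

_-_ : ℝ → ℝ → ℝ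
x - y = x + (- y)

_*_ : ℝ → ℝ → ℝ
x * y = mkℝ (λ n → seq x n ℚ.* seq y n)
            (*-cauchy (seq x) (seq y) (cauchy x) (cauchy y))

-- The junk value at 0 only affects finitely many terms of a sequence that is
-- apart from 0.
inv : ℚ → ℚ
inv q with q ℚ.≟ 0ℚ
... | yes _   = 0ℚ
... | no  q≢0 = ℚ.1/_ q {{ℚ.≢-nonZero q≢0}}

abstract

  inv-* : ∀ q → 0ℚ ℚ.< ∣ q ∣ → inv q ℚ.* q ≡ 1ℚ
  inv-* q 0<∣q∣ with q ℚ.≟ 0ℚ
  ... | yes refl = contradiction 0<∣q∣ (ℚ.<-irrefl refl)
  ... | no  q≢0  = ℚ.*-inverseˡ q {{ℚ.≢-nonZero q≢0}}

  bounded-below : ∀ x → x # 0ℝ → ∃ λ δ → 0ℚ ℚ.< δ ×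
    ∃ λ N → ∀ n → N ℕ.≤ n → δ ℚ.< ∣ seq x n ∣
  bounded-below x (inj₁ (δ , 0<δ , N , x+δ<0)) = δ , 0<δ , N , λ n N≤n →
    ℚ.<-≤-trans
      (subst₂ ℚ._<_ (cancel (seq x n) δ) (ℚ.+-identityʳ _)
        (ℚ.+-monoʳ-< (ℚ.- seq x n) (x+δ<0 n N≤n)))
      (subst (ℚ.- seq x n ℚ.≤_) (ℚ.∣-p∣≡∣p∣ (seq x n)) (p≤∣p∣ (ℚ.- seq x n)))
    where
    open +-*-Solver
    cancel : ∀ a b → ℚ.- a ℚ.+ (a ℚ.+ b) ≡ b
    cancel = solve 2 (λ a b → :- a :+ (a :+ b) := b) refl
  bounded-below x (inj₂ (δ , 0<δ , N , 0+δ<x)) = δ , 0<δ , N , λ n N≤n →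
    ℚ.<-≤-trans (subst (ℚ._< seq x n) (ℚ.+-identityˡ δ) (0+δ<x n N≤n))
      (p≤∣p∣ (seq x n))

  inv-cauchy : ∀ x → x # 0ℝ → IsCauchy (λ n → inv (seq x n))
  inv-cauchy x x#0 ε 0<ε with bounded-below x x#0
  ... | δ , 0<δ , M , δ<∣x∣
    with cauchy x (ε ℚ.* (δ ℚ.* δ)) (0<* 0<ε (0<* 0<δ 0<δ))
  ... | N , close = M ℕ.⊔ N , λ m n hm hn →
    go (seq x m) (seq x n)
      (δ<∣x∣ m (ℕ.m⊔n≤o⇒m≤o M N hm)) (δ<∣x∣ n (ℕ.m⊔n≤o⇒m≤o M N hn))
      (close n m (ℕ.m⊔n≤o⇒n≤o M N hn) (ℕ.m⊔n≤o⇒n≤o M N hm))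
    where
    go : ∀ a b → δ ℚ.< ∣ a ∣ → δ ℚ.< ∣ b ∣ →
      ∣ b ℚ.- a ∣ ℚ.< ε ℚ.* (δ ℚ.* δ) → ∣ inv a ℚ.- inv b ∣ ℚ.< ε
    go a b δ<a δ<b b-a<η =
      ℚ.*-cancelʳ-<-nonNeg ∣ a ℚ.* b ∣ {{ℚ.∣-∣-nonNeg (a ℚ.* b)}}
        (subst (ℚ._< ε ℚ.* ∣ a ℚ.* b ∣) (sym difference)
          (ℚ.<-trans b-a<η
            (ℚ.*-monoʳ-<-pos ε {{ℚ.positive 0<ε}}
              (subst (δ ℚ.* δ ℚ.<_) (sym (ℚ.∣p*q∣≡∣p∣*∣q∣ a b))
                (*-mono-<′ (ℚ.<⇒≤ 0<δ) δ<a (ℚ.<⇒≤ 0<δ) δ<b)))))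
      where
      product : (inv a ℚ.- inv b) ℚ.* (a ℚ.* b) ≡ b ℚ.- a
      product = trans (split-inv (inv a) (inv b) a b) (cong₂ ℚ._-_
        (trans (cong (ℚ._* b) (inv-* a (ℚ.<-trans 0<δ δ<a))) (ℚ.*-identityˡ b))
        (trans (cong (ℚ._* a) (inv-* b (ℚ.<-trans 0<δ δ<b))) (ℚ.*-identityˡ a)))
      difference : ∣ inv a ℚ.- inv b ∣ ℚ.* ∣ a ℚ.* b ∣ ≡ ∣ b ℚ.- a ∣
      difference = trans (sym (ℚ.∣p*q∣≡∣p∣*∣q∣ (inv a ℚ.- inv b) (a ℚ.* b)))
        (cong ∣_∣ product)

recip : (x : ℝ) → x # 0ℝ → ℝ
recip x x#0 = mkℝ (λ n → inv (seq x n)) (inv-cauchy x x#0)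

_÷_⟨_⟩ : ℝ → (y : ℝ) → y # 0ℝ → ℝ
x ÷ y ⟨ y#0 ⟩ = x * recip y y#0

------------------------------------------------------------------------
-- The game: player i controls vᵢ, whence one may exit to aᵢ or move to the
-- other vⱼ.  The outcome c is infinite play.

data Player : Set where
  one two : Player

data Position : Set where
  v₁ v₂ : Position

data Outcome : Set where
  a₁ a₂ c : Outcome

Payoff : Set
Payoff = Player → Outcome → ℝ

-- prob is the probability of following the cycle.
record MixedStrategy : Set where
  field
    prob   : ℝ
    0≤prob : 0ℝ ≤ prob
    prob≤1 : prob ≤ 1ℝ

open MixedStrategy public

Profile : Set
Profile = Player → MixedStrategy

_[_≔_] : Profile → Player → MixedStrategy → Profile
(s [ one ≔ t ]) one = t
(s [ one ≔ t ]) two = s two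
(s [ two ≔ t ]) one = s one
(s [ two ≔ t ]) two = t

-- The case distinction in the limit distribution of the Markov realization.
-- For p₁, p₂ ∈ [0,1] the cases are exclusive and, classically, exhaustive;
-- equality of reals is not decidable, so a case is supplied as evidence.
data Case (p₁ p₂ : ℝ) : Set where
  cycling     : p₁ ≈ 1ℝ → p₂ ≈ 1ℝ → Case p₁ p₂
  terminating : (1ℝ - p₁ * p₂) # 0ℝ → Case p₁ p₂

-- Summing over the number of completed cycles, Σₖ (p₁p₂)ᵏ = 1/(1 - p₁p₂).
distribution : (p₁ p₂ : ℝ) → Case p₁ p₂ → Position → Outcome → ℝ
distribution p₁ p₂ (cycling _ _)   _  a₁ = 0ℝ
distribution p₁ p₂ (cycling _ _)   _  a₂ = 0ℝ
distribution p₁ p₂ (cycling _ _)   _  c  = 1ℝ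
distribution p₁ p₂ (terminating d) v₁ a₁ = (1ℝ - p₁) ÷ (1ℝ - p₁ * p₂) ⟨ d ⟩
distribution p₁ p₂ (terminating d) v₁ a₂ = (p₁ * (1ℝ - p₂)) ÷ (1ℝ - p₁ * p₂) ⟨ d ⟩
distribution p₁ p₂ (terminating d) v₁ c  = 0ℝ
distribution p₁ p₂ (terminating d) v₂ a₁ = (p₂ * (1ℝ - p₁)) ÷ (1ℝ - p₁ * p₂) ⟨ d ⟩
distribution p₁ p₂ (terminating d) v₂ a₂ = (1ℝ - p₂) ÷ (1ℝ - p₁ * p₂) ⟨ d ⟩
distribution p₁ p₂ (terminating d) v₂ c  = 0ℝ

ProfileCase : Profile → Set
ProfileCase s = Case (prob (s one)) (prob (s two))

expectedPayoff : Payoff → (s : Profile) → ProfileCase s → Position → Player → ℝ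
expectedPayoff u s k v i = P a₁ * u i a₁ + P a₂ * u i a₂ + P c * u i c
  where
  P : Outcome → ℝ
  P = distribution (prob (s one)) (prob (s two)) k v

-- Expected payoffs do not depend, up to _≈_, on the evidence k and k′.
IsUNE : Payoff → Profile → Set
IsUNE u s = ∀ (v : Position) (i : Player) (t : MixedStrategy)
  (k : ProfileCase s) (k′ : ProfileCase (s [ i ≔ t ])) →
  ¬ (expectedPayoff u (s [ i ≔ t ]) k′ v i > expectedPayoff u s k v i)

{-# OPTIONS --safe #-}

-- A payoff from a terminating profile becomes a polynomial after multiplication by
-- 1 − p₁p₂, so payoffs are compared by cross-multiplication.  If p₂ < 1, then player 2
-- gains from v₂ by always continuing when p₁ < 1, and player 1 gains from v₁ by exiting
-- when 0 < p₁; one of the two is the case.  So p₂ ≈ 1.  If now p₁ < 1, then player 1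
-- gains by continuing forever; otherwise p₁ ≈ 1 and player 2 gains by exiting.

module Submission where

open import Data.Nat.Base as ℕ using (ℕ)
import Data.Nat.Properties as ℕ
open import Data.Product using (∃; _×_; _,_)
open import Data.Rational.Base as ℚ using (ℚ; 0ℚ; 1ℚ; ½; ∣_∣)
import Data.Rational.Properties as ℚ
open import Data.Rational.Solver using (module +-*-Solver)
open import Data.Sum using (_⊎_; inj₁; inj₂; fromInj₁; fromInj₂; [_,_]′)
open import Relation.Binary.PropositionalEquality
  using (_≡_; refl; sym; trans; cong; cong₂; subst; subst₂)
open import Relation.Nullary using (¬_; yes; no; contradiction)
open import Relation.Nullary.Decidable using (from-yes)
open import Defs

-- Properties of sequences that hold from some index on.

Eventually : (ℕ → Set) → Set
Eventually P = ∃ λ N → ∀ n → N ℕ.≤ n → P n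

always : ∀ {P : ℕ → Set} → (∀ n → P n) → Eventually P
always p = 0 , λ n _ → p n

map : ∀ {P Q : ℕ → Set} → (∀ n → P n → Q n) → Eventually P → Eventually Q
map f (N , p) = N , λ n N≤n → f n (p n N≤n)

zipWith : ∀ {P Q R : ℕ → Set} → (∀ n → P n → Q n → R n) →
  Eventually P → Eventually Q → Eventually R
zipWith f (M , p) (N , q) = M ℕ.⊔ N , λ n h →
  f n (p n (ℕ.m⊔n≤o⇒m≤o M N h)) (q n (ℕ.m⊔n≤o⇒n≤o M N h))

infix 4 _≐_

-- Finer than `_≈_`: ring identities hold in this sense termwise, by the rational solver. Finitely
-- many exceptions are allowed because `inv` inverts only nonzero terms.
_≐_ : ℝ → ℝ → Set
x ≐ y = Eventually λ n → seq x n ≡ seq y n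

-- Inequalities between rationals.

p<p+q : ∀ p {q} → 0ℚ ℚ.< q → p ℚ.< p ℚ.+ q
p<p+q p {q} 0<q = subst (ℚ._< p ℚ.+ q) (ℚ.+-identityʳ p) (ℚ.+-monoʳ-< p 0<q)

∣p∣<q : ∀ {p q} → p ℚ.< q → ℚ.- p ℚ.< q → ∣ p ∣ ℚ.< q
∣p∣<q {p} {q} p<q -p<q with ℚ.∣p∣≡p∨∣p∣≡-p p
... | inj₁ eq = subst (ℚ._< q) (sym eq) p<q
... | inj₂ eq = subst (ℚ._< q) (sym eq) -p<q

∣p-q∣<r⇒p<q+r : ∀ p q {r} → ∣ p ℚ.- q ∣ ℚ.< r → p ℚ.< q ℚ.+ r
∣p-q∣<r⇒p<q+r p q h = subst (ℚ._< q ℚ.+ _) (sym (a≡b+[a-b] p q))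
  (ℚ.+-monoʳ-< q (ℚ.≤-<-trans (p≤∣p∣ (p ℚ.- q)) h))

-- The order on the reals.

<-trans : ∀ {x y z} → x < y → y < z → x < z
<-trans {x} {y} (ε , 0<ε , x<y) (δ , 0<δ , y<z) = ε , 0<ε ,
  zipWith (λ n x<y y<z → ℚ.<-trans x<y (ℚ.<-trans (p<p+q (seq y n) 0<δ) y<z)) x<y y<z

-- Adding `y - w` to both sides keeps the same gap, so moving terms across a strict inequality
-- reduces to a ring identity between differences.
<-cong-difference : ∀ {w x y z} → x - w ≐ z - y → w < x → y < z
<-cong-difference {w} {x} {y} {z} eq (ε , 0<ε , w<x) = ε , 0<ε ,
  zipWith (λ n eq w<x → subst₂ ℚ._<_
    (rearrange (seq w n) (seq y n) ε)
    (trans (move (seq w n) (seq x n) (seq y n))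
      (trans (cong (seq y n ℚ.+_) eq) (sym (a≡b+[a-b] (seq z n) (seq y n)))))
    (ℚ.+-monoʳ-< (seq y n ℚ.- seq w n) w<x)) eq w<x
  where
  open +-*-Solver
  rearrange : ∀ w y ε → (y ℚ.- w) ℚ.+ (w ℚ.+ ε) ≡ y ℚ.+ ε
  rearrange = solve 3 (λ w y ε → (y :- w) :+ (w :+ ε) := y :+ ε) refl
  move : ∀ w x y → (y ℚ.- w) ℚ.+ x ≡ y ℚ.+ (x ℚ.- w)
  move = solve 3 (λ w x y → (y :- w) :+ x := y :+ (x :- w)) refl

x<y⇒0<y-x : ∀ {x y} → x < y → 0ℝ < y - x
x<y⇒0<y-x {x} {y} = <-cong-difference {x} {y} {0ℝ} {y - x}
  (always λ n → sym (ℚ.+-identityʳ (seq y n ℚ.- seq x n)))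

0<y-x⇒x<y : ∀ {x y} → 0ℝ < y - x → x < y
0<y-x⇒x<y {x} {y} = <-cong-difference {0ℝ} {y - x} {x} {y}
  (always λ n → ℚ.+-identityʳ (seq y n ℚ.- seq x n))

x≤y⇒0≤y-x : ∀ {x y} → x ≤ y → 0ℝ ≤ y - x
x≤y⇒0≤y-x {x} {y} x≤y y-x<0 = x≤y
  (<-cong-difference {y - x} {0ℝ} {y} {x}
    (always λ n → identity (seq x n) (seq y n)) y-x<0)
  where
  open +-*-Solver
  identity : ∀ x y → 0ℚ ℚ.- (y ℚ.- x) ≡ x ℚ.- y
  identity = solve 2 (λ x y → con 0ℚ :- (y :- x) := x :- y) refl

fromℚ-mono-≤ : ∀ {p q} → p ℚ.≤ q → fromℚ p ≤ fromℚ q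
fromℚ-mono-≤ {p} {q} p≤q (ε , 0<ε , N , q+ε<p) =
  ℚ.<-irrefl refl
    (ℚ.<-trans (p<p+q q 0<ε) (ℚ.<-≤-trans (q+ε<p N ℕ.≤-refl) p≤q))

0<1 : 0ℝ < 1ℝ
0<1 = ½ , ℚ.positive⁻¹ ½ , always λ _ → from-yes (0ℚ ℚ.+ ½ ℚ.<? 1ℚ)

-- Serves as the constructive substitute for trichotomy. One rational comparison at a late index `K`
-- decides, since by then `x` and `z` move by less than `h`.
<-cotrans : ∀ {x y} → x < y → ∀ z → x < z ⊎ z < y
<-cotrans {x} {y} (ε , 0<ε , L , x<y) z
  -- The threshold `3h` pays for the drifts of `x` and `z` and a gap `h` when `z` is far above `x`.
  -- Otherwise the threshold, both drifts and a gap `h` add up to `6h`, which is `ε`.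
  with quotient six (ℚ.positive⁻¹ six) ε 0<ε
  where
  six : ℚ
  six = 1ℚ ℚ.+ 1ℚ ℚ.+ 1ℚ ℚ.+ 1ℚ ℚ.+ 1ℚ ℚ.+ 1ℚ
... | h , 0<h , 6h≡ε with cauchy x h 0<h | cauchy z h 0<h
... | M , closeˣ | N , closeᶻ = compare
  where
  open +-*-Solver
  open ℚ.≤-Reasoning
  K : ℕ
  K = M ℕ.⊔ N
  M≤K : M ℕ.≤ K
  M≤K = ℕ.m≤m⊔n M N
  N≤K : N ℕ.≤ K
  N≤K = ℕ.m≤n⊔m M N
  3h : ℚ
  3h = h ℚ.+ h ℚ.+ h
  drop-h : ∀ a h → a ℚ.+ h ℚ.+ h ≡ a ℚ.+ (h ℚ.+ h ℚ.+ h) ℚ.- h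
  drop-h = solve 2 (λ a h → a :+ h :+ h := a :+ (h :+ h :+ h) :- h) refl
  add-sub : ∀ a h → a ℚ.+ h ℚ.- h ≡ a
  add-sub = solve 2 (λ a h → a :+ h :- h := a) refl
  six-h : ∀ a h → a ℚ.+ h ℚ.+ (h ℚ.+ h ℚ.+ h) ℚ.+ h ℚ.+ h
                ≡ a ℚ.+ (1ℚ ℚ.+ 1ℚ ℚ.+ 1ℚ ℚ.+ 1ℚ ℚ.+ 1ℚ ℚ.+ 1ℚ) ℚ.* h
  six-h = solve 2 (λ a h → a :+ h :+ (h :+ h :+ h) :+ h :+ h
    := a :+ con (1ℚ ℚ.+ 1ℚ ℚ.+ 1ℚ ℚ.+ 1ℚ ℚ.+ 1ℚ ℚ.+ 1ℚ) :* h) refl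
  x<z : seq x K ℚ.+ 3h ℚ.≤ seq z K → ∀ n → K ℕ.≤ n → seq x n ℚ.+ h ℚ.< seq z n
  x<z far n K≤n = begin-strict
    seq x n ℚ.+ h
      <⟨ ℚ.+-monoˡ-< h (∣p-q∣<r⇒p<q+r (seq x n) (seq x K)
           (closeˣ n K (ℕ.≤-trans M≤K K≤n) M≤K)) ⟩
    seq x K ℚ.+ h ℚ.+ h     ≡⟨ drop-h (seq x K) h ⟩
    seq x K ℚ.+ 3h ℚ.- h    ≤⟨ ℚ.+-monoˡ-≤ (ℚ.- h) far ⟩
    seq z K ℚ.- h
      <⟨ ℚ.+-monoˡ-< (ℚ.- h) (∣p-q∣<r⇒p<q+r (seq z K) (seq z n)
           (closeᶻ K n N≤K (ℕ.≤-trans N≤K K≤n))) ⟩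
    seq z n ℚ.+ h ℚ.- h     ≡⟨ add-sub (seq z n) h ⟩
    seq z n                 ∎
  z<y : seq z K ℚ.< seq x K ℚ.+ 3h →
    ∀ n → K ℕ.⊔ L ℕ.≤ n → seq z n ℚ.+ h ℚ.< seq y n
  z<y near n KL≤n = begin-strict
    seq z n ℚ.+ h
      <⟨ ℚ.+-monoˡ-< h (∣p-q∣<r⇒p<q+r (seq z n) (seq z K)
           (closeᶻ n K (ℕ.≤-trans N≤K K≤n) N≤K)) ⟩
    seq z K ℚ.+ h ℚ.+ h
      <⟨ ℚ.+-monoˡ-< h (ℚ.+-monoˡ-< h near) ⟩
    seq x K ℚ.+ 3h ℚ.+ h ℚ.+ h
      <⟨ ℚ.+-monoˡ-< h (ℚ.+-monoˡ-< h (ℚ.+-monoˡ-< 3h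
           (∣p-q∣<r⇒p<q+r (seq x K) (seq x n)
             (closeˣ K n M≤K (ℕ.≤-trans M≤K K≤n))))) ⟩
    seq x n ℚ.+ h ℚ.+ 3h ℚ.+ h ℚ.+ h
      ≡⟨ trans (six-h (seq x n) h) (cong (seq x n ℚ.+_) 6h≡ε) ⟩
    seq x n ℚ.+ ε
      <⟨ x<y n (ℕ.m⊔n≤o⇒n≤o K L KL≤n) ⟩
    seq y n ∎
    where
    K≤n : K ℕ.≤ n
    K≤n = ℕ.m⊔n≤o⇒m≤o K L KL≤n
  compare : x < z ⊎ z < y
  compare with seq x K ℚ.+ 3h ℚ.≤? seq z K
  ... | yes far = inj₁ (h , 0<h , K , x<z far)
  ... | no near = inj₂ (h , 0<h , K ℕ.⊔ L , z<y (ℚ.≰⇒> near))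

-- Both hypotheses are negations. Cotransitivity applied to `w < w + ε` makes them positive: of its
-- two alternatives, `w < z` is refuted and `z < w + ε` remains.
≤-antisym : ∀ {x y} → x ≤ y → y ≤ x → x ≈ y
≤-antisym {x} {y} x≤y y≤x ε 0<ε =
  zipWith (λ n x<y+ε y<x+ε → ∣p∣<q (bound (seq x n) (seq y n) x<y+ε)
      (subst (ℚ._< ε) (sym (-[a-b]≡b-a (seq x n) (seq y n)))
        (bound (seq y n) (seq x n) y<x+ε)))
    (below y x x≤y) (below x y y≤x)
  where
  open +-*-Solver
  add-sub : ∀ a b → a ℚ.+ b ℚ.- a ≡ b
  add-sub = solve 2 (λ a b → a :+ b :- a := b) refl
  bound : ∀ a b → a ℚ.< b ℚ.+ ε → a ℚ.- b ℚ.< ε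
  bound a b a<b+ε = subst (a ℚ.- b ℚ.<_) (add-sub b ε) (ℚ.+-monoˡ-< (ℚ.- b) a<b+ε)
  below : ∀ w z → z ≤ w → Eventually λ n → seq z n ℚ.< seq w n ℚ.+ ε
  below w z z≤w =
    let δ , 0<δ , z<w+ε = fromInj₂ (λ w<z → contradiction w<z z≤w)
          (<-cotrans {w} {w + fromℚ ε} w<w+ε z)
    in map (λ n → ℚ.<-trans (p<p+q (seq z n) 0<δ)) z<w+ε
    where
    0<ε/2 : 0ℚ ℚ.< ε ℚ.* ½
    0<ε/2 = 0<* 0<ε (ℚ.positive⁻¹ ½)
    w<w+ε : w < w + fromℚ ε
    w<w+ε = ε ℚ.* ½ , 0<ε/2 , always λ n → ℚ.+-monoʳ-< (seq w n)
      (subst (ε ℚ.* ½ ℚ.<_) (half+half ε) (p<p+q (ε ℚ.* ½) 0<ε/2))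

-- Signs of products and sums, and comparison of fractions.

0<x*y : ∀ {x y} → 0ℝ < x → 0ℝ < y → 0ℝ < x * y
0<x*y {x} {y} (ε , 0<ε , ε<x) (δ , 0<δ , δ<y) = ε ℚ.* δ , 0<* 0<ε 0<δ ,
  zipWith (λ n ε<x δ<y → subst (ℚ._< seq x n ℚ.* seq y n)
    (sym (ℚ.+-identityˡ (ε ℚ.* δ)))
    (*-mono-<′ (ℚ.<⇒≤ 0<ε) (subst (ℚ._< seq x n) (ℚ.+-identityˡ ε) ε<x)
               (ℚ.<⇒≤ 0<δ) (subst (ℚ._< seq y n) (ℚ.+-identityˡ δ) δ<y))) ε<x δ<y

-- If `x * d` exceeds `ε` and `d` stays below `B`, then `x` exceeds `ε / B`, a uniform gap.
0<x*d⇒0<x : ∀ {x d} → 0ℝ < d → 0ℝ < x * d → 0ℝ < x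
0<x*d⇒0<x {x} {d} (δ , 0<δ , δ<d) (ε , 0<ε , ε<xd)
  with bounded (seq d) (cauchy d)
... | B , 0<B , d<B with quotient B 0<B ε 0<ε
... | η , 0<η , Bη≡ε = η , 0<η ,
  zipWith (λ n f g → f g) (zipWith step δ<d d<B) ε<xd
  where
  open ℚ.≤-Reasoning
  step : ∀ n → 0ℚ ℚ.+ δ ℚ.< seq d n → ∣ seq d n ∣ ℚ.< B →
    0ℚ ℚ.+ ε ℚ.< seq x n ℚ.* seq d n → 0ℚ ℚ.+ η ℚ.< seq x n
  step n δ<d d<B ε<xd = ℚ.*-cancelʳ-<-nonNeg (seq d n)
    {{ℚ.nonNegative (ℚ.<⇒≤ (ℚ.<-trans (p<p+q 0ℚ 0<δ) δ<d))}} (begin-strict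
      (0ℚ ℚ.+ η) ℚ.* seq d n ≡⟨ cong (ℚ._* seq d n) (ℚ.+-identityˡ η) ⟩
      η ℚ.* seq d n
        <⟨ ℚ.*-monoʳ-<-pos η {{ℚ.positive 0<η}} (ℚ.≤-<-trans (p≤∣p∣ (seq d n)) d<B) ⟩
      η ℚ.* B                ≡⟨ ℚ.*-comm η B ⟩
      B ℚ.* η                ≡⟨ Bη≡ε ⟩
      ε                      ≡⟨ ℚ.+-identityˡ ε ⟨
      0ℚ ℚ.+ ε               <⟨ ε<xd ⟩
      seq x n ℚ.* seq d n    ∎)

0≤x*d : ∀ {x d} → 0ℝ ≤ x → 0ℝ < d → 0ℝ ≤ x * d
0≤x*d {x} {d} 0≤x 0<d xd<0 = 0≤x
  (<-cong-difference {0ℝ} { - x} {x} {0ℝ} (always λ n → negate (seq x n))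
    (0<x*d⇒0<x { - x} {d} 0<d
      (<-cong-difference {x * d} {0ℝ} {0ℝ} {(- x) * d}
        (always λ n → negate-* (seq x n) (seq d n)) xd<0)))
  where
  open +-*-Solver
  negate : ∀ x → ℚ.- x ℚ.- 0ℚ ≡ 0ℚ ℚ.- x
  negate = solve 1 (λ x → :- x :- con 0ℚ := con 0ℚ :- x) refl
  negate-* : ∀ x d → 0ℚ ℚ.- x ℚ.* d ≡ (ℚ.- x) ℚ.* d ℚ.- 0ℚ
  negate-* = solve 2 (λ x d → con 0ℚ :- x :* d := (:- x) :* d :- con 0ℚ) refl

-- Since `- x < 0`, cotransitivity gives `- x < y` or `y < 0`, and the latter is excluded.
0<x+y : ∀ {x y} → 0ℝ < x → 0ℝ ≤ y → 0ℝ < x + y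
0<x+y {x} {y} 0<x 0≤y = <-cong-difference { - x} {y} {0ℝ} {x + y}
  (always λ n → sum (seq x n) (seq y n))
  (fromInj₁ (λ y<0 → contradiction y<0 0≤y)
    (<-cotrans { - x} {0ℝ} (<-cong-difference {0ℝ} {x} { - x} {0ℝ}
      (always λ n → negate (seq x n)) 0<x) y))
  where
  open +-*-Solver
  negate : ∀ x → x ℚ.- 0ℚ ≡ 0ℚ ℚ.- (ℚ.- x)
  negate = solve 1 (λ x → x :- con 0ℚ := con 0ℚ :- (:- x)) refl
  sum : ∀ x y → y ℚ.- (ℚ.- x) ≡ x ℚ.+ y ℚ.- 0ℚ
  sum = solve 2 (λ x y → y :- (:- x) := x :+ y :- con 0ℚ) refl

-- Eventually `v * d - u * e` equals `(y - x) * (d * e)`, from which the positive factor `d * e`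
-- cancels.
<-cross-multiply : ∀ {x y d e u v} → 0ℝ < d → 0ℝ < e →
  x * d ≐ u → y * e ≐ v → 0ℝ < v * d - u * e → x < y
<-cross-multiply {x} {y} {d} {e} {u} {v} 0<d 0<e xd≐u ye≐v 0<vd-ue =
  0<y-x⇒x<y {x} {y} (0<x*d⇒0<x {y - x} {d * e} (0<x*y {d} {e} 0<d 0<e)
    (<-cong-difference {0ℝ} {v * d - u * e} {0ℝ} {(y - x) * (d * e)}
      (zipWith (λ n xd≡u ye≡v → cong (ℚ._- 0ℚ)
        (trans (cong₂ (λ v u → v ℚ.* seq d n ℚ.- u ℚ.* seq e n) (sym ye≡v) (sym xd≡u))
          (expand (seq x n) (seq y n) (seq d n) (seq e n)))) xd≐u ye≐v)
      0<vd-ue))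
  where
  open +-*-Solver
  expand : ∀ x y d e →
    (y ℚ.* e) ℚ.* d ℚ.- (x ℚ.* d) ℚ.* e ≡ (y ℚ.- x) ℚ.* (d ℚ.* e)
  expand = solve 4 (λ x y d e →
    (y :* e) :* d :- (x :* d) :* e := (y :- x) :* (d :* e)) refl

0<x∧x≐y⇒0<y : ∀ {x y} → 0ℝ < x → x ≐ y → 0ℝ < y
0<x∧x≐y⇒0<y {x} {y} 0<x x≐y =
  <-cong-difference {0ℝ} {x} {0ℝ} {y} (map (λ n → cong (ℚ._- 0ℚ)) x≐y) 0<x

-- Write `1 - xy` as `y(1 - x) + (1 - y)`. Both summands are nonnegative; the first is positive if
-- `0 < y`, the second if `y < 1`, and cotransitivity provides one of these.
x<1∧0≤y≤1⇒0<1-xy : ∀ {x y} → x < 1ℝ → 0ℝ ≤ y → y ≤ 1ℝ → 0ℝ < 1ℝ - x * y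
x<1∧0≤y≤1⇒0<1-xy {x} {y} x<1 0≤y y≤1 =
  0<x∧x≐y⇒0<y {y * (1ℝ - x) + (1ℝ - y)} {1ℝ - x * y}
    ([ 0<y⇒ , y<1⇒ ]′ (<-cotrans {0ℝ} {1ℝ} 0<1 y))
    (always λ n → identity (seq x n) (seq y n))
  where
  open +-*-Solver
  identity : ∀ x y → y ℚ.* (1ℚ ℚ.- x) ℚ.+ (1ℚ ℚ.- y) ≡ 1ℚ ℚ.- x ℚ.* y
  identity = solve 2 (λ x y →
    y :* (con 1ℚ :- x) :+ (con 1ℚ :- y) := con 1ℚ :- x :* y) refl
  0<1-x : 0ℝ < 1ℝ - x
  0<1-x = x<y⇒0<y-x {x} {1ℝ} x<1
  0<y⇒ : 0ℝ < y → 0ℝ < y * (1ℝ - x) + (1ℝ - y)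
  0<y⇒ 0<y = 0<x+y {y * (1ℝ - x)} {1ℝ - y}
    (0<x*y {y} {1ℝ - x} 0<y 0<1-x) (x≤y⇒0≤y-x {y} {1ℝ} y≤1)
  y<1⇒ : y < 1ℝ → 0ℝ < y * (1ℝ - x) + (1ℝ - y)
  y<1⇒ y<1 = 0<x∧x≐y⇒0<y
    {(1ℝ - y) + y * (1ℝ - x)} {y * (1ℝ - x) + (1ℝ - y)}
    (0<x+y {1ℝ - y} {y * (1ℝ - x)}
      (x<y⇒0<y-x {y} {1ℝ} y<1) (0≤x*d {y} {1ℝ - x} 0≤y 0<1-x))
    (always λ n → ℚ.+-comm (1ℚ ℚ.- seq y n) (seq y n ℚ.* (1ℚ ℚ.- seq x n)))

-- Pure deviations, and payoffs cleared of denominators.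

constant : ∀ q → 0ℚ ℚ.≤ q → q ℚ.≤ 1ℚ → MixedStrategy
constant q 0≤q q≤1 = record
  { prob = fromℚ q ; 0≤prob = fromℚ-mono-≤ 0≤q ; prob≤1 = fromℚ-mono-≤ q≤1 }

exit continue : MixedStrategy
exit     = constant 0ℚ ℚ.≤-refl (from-yes (0ℚ ℚ.≤? 1ℚ))
continue = constant 1ℚ (from-yes (0ℚ ℚ.≤? 1ℚ)) ℚ.≤-refl

-- The probability that a full round of the cycle is not completed; the common denominator of the
-- terminating distributions.
escape : Profile → ℝ
escape s = 1ℝ - prob (s one) * prob (s two)

0<escape-one : ∀ s → prob (s one) < 1ℝ → 0ℝ < escape s
0<escape-one s p<1 = x<1∧0≤y≤1⇒0<1-xy {prob (s one)} {prob (s two)}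
  p<1 (0≤prob (s two)) (prob≤1 (s two))

0<escape-two : ∀ s → prob (s two) < 1ℝ → 0ℝ < escape s
0<escape-two s q<1 = 0<x∧x≐y⇒0<y {1ℝ - q * p} {1ℝ - p * q}
  (x<1∧0≤y≤1⇒0<1-xy {q} {p} q<1 (0≤prob (s one)) (prob≤1 (s one)))
  (always λ n → cong (λ z → 1ℚ ℚ.- z) (ℚ.*-comm (seq q n) (seq p n)))
  where
  p q : ℝ
  p = prob (s one)
  q = prob (s two)

terminating-payoff : ∀ x y α β γ d (d#0 : d # 0ℝ) →
  ((x ÷ d ⟨ d#0 ⟩) * α + (y ÷ d ⟨ d#0 ⟩) * β + 0ℝ * γ) * d ≐ x * α + y * β
terminating-payoff x y α β γ d d#0 with bounded-below d d#0
... | δ , 0<δ , N , δ<∣d∣ = N , λ n N≤n → cancel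
  (seq x n) (seq y n) (seq α n) (seq β n) (seq γ n) (seq d n) (inv (seq d n))
  (inv-* (seq d n) (ℚ.<-trans 0<δ (δ<∣d∣ n N≤n)))
  where
  open +-*-Solver
  collect : ∀ x y α β γ d r →
    (x ℚ.* r ℚ.* α ℚ.+ y ℚ.* r ℚ.* β ℚ.+ 0ℚ ℚ.* γ) ℚ.* d
      ≡ (r ℚ.* d) ℚ.* (x ℚ.* α ℚ.+ y ℚ.* β)
  collect = solve 7 (λ x y α β γ d r →
    (x :* r :* α :+ y :* r :* β :+ con 0ℚ :* γ) :* d
      := (r :* d) :* (x :* α :+ y :* β)) refl
  cancel : ∀ x y α β γ d r → r ℚ.* d ≡ 1ℚ →
    (x ℚ.* r ℚ.* α ℚ.+ y ℚ.* r ℚ.* β ℚ.+ 0ℚ ℚ.* γ) ℚ.* d ≡ x ℚ.* α ℚ.+ y ℚ.* β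
  cancel x y α β γ d r rd≡1 = trans (collect x y α β γ d r)
    (trans (cong (ℚ._* (x ℚ.* α ℚ.+ y ℚ.* β)) rd≡1) (ℚ.*-identityˡ _))

-- The factor `1ℝ` acts as a denominator, so that `<-cross-multiply` covers cycling profiles too.
cycling-payoff : ∀ α β γ → (0ℝ * α + 0ℝ * β + 1ℝ * γ) * 1ℝ ≐ γ
cycling-payoff α β γ = always λ n → identity (seq α n) (seq β n) (seq γ n)
  where
  open +-*-Solver
  identity : ∀ α β γ → (0ℚ ℚ.* α ℚ.+ 0ℚ ℚ.* β ℚ.+ 1ℚ ℚ.* γ) ℚ.* 1ℚ ≡ γ
  identity = solve 3 (λ α β γ →
    (con 0ℚ :* α :+ con 0ℚ :* β :+ con 1ℚ :* γ) :* con 1ℚ := γ) refl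

-- Profitable deviations.

module Deviations (u : Payoff) (s : Profile) (une : IsUNE u s) where

  p q : ℝ
  p = prob (s one)
  q = prob (s two)

  -- With `p < 1`, continuing makes `a₁` certain from `v₂`. The cross-multiplied gain is
  -- `(1 - p)(1 - q)(α - β)`.
  continuing-improves-two :
    u two a₂ < u two a₁ → p < 1ℝ → ¬ (q < 1ℝ)
  continuing-improves-two β<α p<1 q<1 =
    une v₂ two continue k k′
      (<-cross-multiply
        {expectedPayoff u s k v₂ two} {expectedPayoff u (s [ two ≔ continue ]) k′ v₂ two}
        {d} {d′} {m} {m′}
        0<d 0<d′
        (terminating-payoff (q * (1ℝ - p)) (1ℝ - q) α β γ d (inj₂ 0<d))
        (terminating-payoff (1ℝ * (1ℝ - p)) (1ℝ - 1ℝ) α β γ d′ (inj₂ 0<d′))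
        (0<x∧x≐y⇒0<y {(1ℝ - p) * (1ℝ - q) * (α - β)}
          {m′ * d - m * d′}
          (0<x*y {(1ℝ - p) * (1ℝ - q)} {α - β}
            (0<x*y {1ℝ - p} {1ℝ - q}
              (x<y⇒0<y-x {p} {1ℝ} p<1) (x<y⇒0<y-x {q} {1ℝ} q<1))
            (x<y⇒0<y-x {β} {α} β<α))
          (always λ n → gain (seq p n) (seq q n) (seq α n) (seq β n))))
    where
    open +-*-Solver
    α β γ d d′ : ℝ
    α = u two a₁
    β = u two a₂
    γ = u two c
    d = escape s
    d′ = escape (s [ two ≔ continue ])
    0<d : 0ℝ < d
    0<d = 0<escape-one s p<1
    0<d′ : 0ℝ < d′
    0<d′ = 0<escape-one (s [ two ≔ continue ]) p<1
    m m′ : ℝ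
    m = q * (1ℝ - p) * α + (1ℝ - q) * β
    m′ = 1ℝ * (1ℝ - p) * α + (1ℝ - 1ℝ) * β
    k : ProfileCase s
    k = terminating (inj₂ 0<d)
    k′ : ProfileCase (s [ two ≔ continue ])
    k′ = terminating (inj₂ 0<d′)
    gain : ∀ p q α β →
      (1ℚ ℚ.- p) ℚ.* (1ℚ ℚ.- q) ℚ.* (α ℚ.- β)
        ≡ (1ℚ ℚ.* (1ℚ ℚ.- p) ℚ.* α ℚ.+ (1ℚ ℚ.- 1ℚ) ℚ.* β) ℚ.* (1ℚ ℚ.- p ℚ.* q)
          ℚ.- (q ℚ.* (1ℚ ℚ.- p) ℚ.* α ℚ.+ (1ℚ ℚ.- q) ℚ.* β) ℚ.* (1ℚ ℚ.- p ℚ.* 1ℚ)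
    gain = solve 4 (λ p q α β → let 1# = con 1ℚ in
      (1# :- p) :* (1# :- q) :* (α :- β)
        := (1# :* (1# :- p) :* α :+ (1# :- 1#) :* β) :* (1# :- p :* q)
          :- (q :* (1# :- p) :* α :+ (1# :- q) :* β) :* (1# :- p :* 1#)) refl

  -- Exiting makes `a₁` certain from `v₁`, while `s` reaches `a₂` with positive probability. The
  -- cross-multiplied gain is `p(1 - q)(α - β)`.
  exiting-improves-one :
    u one a₂ < u one a₁ → 0ℝ < p → ¬ (q < 1ℝ)
  exiting-improves-one β<α 0<p q<1 =
    une v₁ one exit k k′
      (<-cross-multiply
        {expectedPayoff u s k v₁ one} {expectedPayoff u (s [ one ≔ exit ]) k′ v₁ one}
        {d} {d′} {m} {m′}
        0<d 0<d′
        (terminating-payoff (1ℝ - p) (p * (1ℝ - q)) α β γ d (inj₂ 0<d))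
        (terminating-payoff (1ℝ - 0ℝ) (0ℝ * (1ℝ - q)) α β γ d′ (inj₂ 0<d′))
        (0<x∧x≐y⇒0<y {p * (1ℝ - q) * (α - β)} {m′ * d - m * d′}
          (0<x*y {p * (1ℝ - q)} {α - β}
            (0<x*y {p} {1ℝ - q} 0<p (x<y⇒0<y-x {q} {1ℝ} q<1))
            (x<y⇒0<y-x {β} {α} β<α))
          (always λ n → gain (seq p n) (seq q n) (seq α n) (seq β n))))
    where
    open +-*-Solver
    α β γ d d′ : ℝ
    α = u one a₁
    β = u one a₂
    γ = u one c
    d = escape s
    d′ = escape (s [ one ≔ exit ])
    0<d : 0ℝ < d
    0<d = 0<escape-two s q<1
    0<d′ : 0ℝ < d′
    -- Player 1 now continues with probability `0ℝ`, so `0<1` is the required bound.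
    0<d′ = 0<escape-one (s [ one ≔ exit ]) 0<1
    m m′ : ℝ
    m = (1ℝ - p) * α + p * (1ℝ - q) * β
    m′ = (1ℝ - 0ℝ) * α + 0ℝ * (1ℝ - q) * β
    k : ProfileCase s
    k = terminating (inj₂ 0<d)
    k′ : ProfileCase (s [ one ≔ exit ])
    k′ = terminating (inj₂ 0<d′)
    gain : ∀ p q α β →
      p ℚ.* (1ℚ ℚ.- q) ℚ.* (α ℚ.- β)
        ≡ ((1ℚ ℚ.- 0ℚ) ℚ.* α ℚ.+ 0ℚ ℚ.* (1ℚ ℚ.- q) ℚ.* β) ℚ.* (1ℚ ℚ.- p ℚ.* q)
          ℚ.- ((1ℚ ℚ.- p) ℚ.* α ℚ.+ p ℚ.* (1ℚ ℚ.- q) ℚ.* β) ℚ.* (1ℚ ℚ.- 0ℚ ℚ.* q)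
    gain = solve 4 (λ p q α β → let 1# = con 1ℚ ; 0# = con 0ℚ in
      p :* (1# :- q) :* (α :- β)
        := ((1# :- 0#) :* α :+ 0# :* (1# :- q) :* β) :* (1# :- p :* q)
          :- ((1# :- p) :* α :+ p :* (1# :- q) :* β) :* (1# :- 0# :* q)) refl

  -- With `q ≈ 1` the deviation produces `c` for certain, the best outcome for player 1, while `s`
  -- terminates.
  continuing-improves-one :
    u one a₁ < u one c → u one a₂ < u one a₁ → 0ℝ < q → q ≈ 1ℝ → ¬ (p < 1ℝ)
  continuing-improves-one α<γ β<α 0<q q≈1 p<1 =
    une v₂ one continue k k′
      (<-cross-multiply
        {expectedPayoff u s k v₂ one} {expectedPayoff u (s [ one ≔ continue ]) k′ v₂ one}
        {d} {1ℝ} {m} {γ}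
        0<d 0<1
        (terminating-payoff (q * (1ℝ - p)) (1ℝ - q) α β γ d (inj₂ 0<d))
        (cycling-payoff α β γ)
        -- From `q ≈ 1` the terms of `1 - q` need not vanish, so the `a₂` summand is kept and
        -- bounded below by zero.
        (0<x∧x≐y⇒0<y {q * (1ℝ - p) * (γ - α) + (1ℝ - q) * (γ - β)}
          {γ * d - m * 1ℝ}
          (0<x+y {q * (1ℝ - p) * (γ - α)} {(1ℝ - q) * (γ - β)}
            (0<x*y {q * (1ℝ - p)} {γ - α}
              (0<x*y {q} {1ℝ - p} 0<q (x<y⇒0<y-x {p} {1ℝ} p<1))
              (x<y⇒0<y-x {α} {γ} α<γ))
            (0≤x*d {1ℝ - q} {γ - β} (x≤y⇒0≤y-x {q} {1ℝ} (prob≤1 (s two)))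
              (x<y⇒0<y-x {β} {γ} (<-trans {β} {α} {γ} β<α α<γ))))
          (always λ n → gain (seq p n) (seq q n) (seq α n) (seq β n) (seq γ n))))
    where
    open +-*-Solver
    α β γ d : ℝ
    α = u one a₁
    β = u one a₂
    γ = u one c
    d = escape s
    0<d : 0ℝ < d
    0<d = 0<escape-one s p<1
    1≈1 : 1ℝ ≈ 1ℝ
    1≈1 = ≤-antisym {1ℝ} {1ℝ} (fromℚ-mono-≤ ℚ.≤-refl) (fromℚ-mono-≤ ℚ.≤-refl)
    m : ℝ
    m = q * (1ℝ - p) * α + (1ℝ - q) * β
    k : ProfileCase s
    k = terminating (inj₂ 0<d)
    k′ : ProfileCase (s [ one ≔ continue ])
    k′ = cycling 1≈1 q≈1
    gain : ∀ p q α β γ →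
      q ℚ.* (1ℚ ℚ.- p) ℚ.* (γ ℚ.- α) ℚ.+ (1ℚ ℚ.- q) ℚ.* (γ ℚ.- β)
        ≡ γ ℚ.* (1ℚ ℚ.- p ℚ.* q)
          ℚ.- (q ℚ.* (1ℚ ℚ.- p) ℚ.* α ℚ.+ (1ℚ ℚ.- q) ℚ.* β) ℚ.* 1ℚ
    gain = solve 5 (λ p q α β γ → let 1# = con 1ℚ in
      q :* (1# :- p) :* (γ :- α) :+ (1# :- q) :* (γ :- β)
        := γ :* (1# :- p :* q)
          :- (q :* (1# :- p) :* α :+ (1# :- q) :* β) :* 1#) refl

  -- The profile cycles forever, and exiting from `v₂` replaces `c` by `a₂` for certain. The
  -- cross-multiplied gain is `β - γ`.
  exiting-improves-two :
    u two c < u two a₂ → p ≈ 1ℝ → ¬ (q ≈ 1ℝ)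
  exiting-improves-two γ<β p≈1 q≈1 =
    une v₂ two exit k k′
      (<-cross-multiply
        {expectedPayoff u s k v₂ two} {expectedPayoff u (s [ two ≔ exit ]) k′ v₂ two}
        {1ℝ} {d′} {γ} {m′}
        0<1 0<d′
        (cycling-payoff α β γ)
        (terminating-payoff (0ℝ * (1ℝ - p)) (1ℝ - 0ℝ) α β γ d′ (inj₂ 0<d′))
        (0<x∧x≐y⇒0<y {β - γ} {m′ * 1ℝ - γ * d′}
          (x<y⇒0<y-x {γ} {β} γ<β)
          (always λ n → gain (seq p n) (seq α n) (seq β n) (seq γ n))))
    where
    open +-*-Solver
    α β γ d′ : ℝ
    α = u two a₁
    β = u two a₂
    γ = u two c
    d′ = escape (s [ two ≔ exit ])
    0<d′ : 0ℝ < d′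
    0<d′ = 0<escape-two (s [ two ≔ exit ]) 0<1
    m′ : ℝ
    m′ = 0ℝ * (1ℝ - p) * α + (1ℝ - 0ℝ) * β
    k : ProfileCase s
    k = cycling p≈1 q≈1
    k′ : ProfileCase (s [ two ≔ exit ])
    k′ = terminating (inj₂ 0<d′)
    gain : ∀ p α β γ →
      β ℚ.- γ ≡ (0ℚ ℚ.* (1ℚ ℚ.- p) ℚ.* α ℚ.+ (1ℚ ℚ.- 0ℚ) ℚ.* β) ℚ.* 1ℚ
        ℚ.- γ ℚ.* (1ℚ ℚ.- p ℚ.* 0ℚ)
    gain = solve 4 (λ p α β γ → let 1# = con 1ℚ ; 0# = con 0ℚ in
      β :- γ := (0# :* (1# :- p) :* α :+ (1# :- 0#) :* β) :* 1#
        :- γ :* (1# :- p :* 0#)) refl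

proposition3 : (u : Payoff) →
    (u one c > u one a₁ × u one a₁ > u one a₂) →
    (u two a₁ > u two a₂ × u two a₂ > u two c) →
    ¬ (∃ λ (s : Profile) → IsUNE u s)
proposition3 u (a₁<₁c , a₂<₁a₁) (a₂<₂a₁ , c<₂a₂) (s , une) =
  exiting-improves-two c<₂a₂ p≈1 q≈1
  where
  open Deviations u s une
  1≤q : 1ℝ ≤ q
  -- The alternatives `0 < p` and `p < 1` overlap, so no equality of reals has to be decided.
  1≤q q<1 =
    [ (λ 0<p → exiting-improves-one a₂<₁a₁ 0<p q<1)
    , (λ p<1 → continuing-improves-two a₂<₂a₁ p<1 q<1)
    ]′ (<-cotrans {0ℝ} {1ℝ} 0<1 p)
  q≈1 : q ≈ 1ℝ
  q≈1 = ≤-antisym {q} {1ℝ} (prob≤1 (s two)) 1≤q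
  0<q : 0ℝ < q
  0<q = fromInj₁ (λ q<1 → contradiction q<1 1≤q) (<-cotrans {0ℝ} {1ℝ} 0<1 q)
  p≈1 : p ≈ 1ℝ
  p≈1 = ≤-antisym {p} {1ℝ} (prob≤1 (s one))
    -- The refutation of `p < 1ℝ` is by definition a proof of `1ℝ ≤ p`.
    (continuing-improves-one a₁<₁c a₂<₁a₁ 0<q q≈1)
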